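{- Let $m\ge4$ and let $(c_1,\dots,c_m)\in\mathbb{C}^m$ be a quiddity cycle with at least one nonzero entry, with associated tame frieze pattern entries $a_{i,j}$. Then there exists a triangulation of the convex $m$-gon with vertices $1,\dots,m$ such that $a_{i,j}\ne0$ for every diagonal $(i,j)$ of the triangulation (i.e. the frieze pattern has a cluster without zero entry).
   Context: $\eta(c)=\begin{pmatrix}c&-1\\1&0\end{pmatrix}$. A quiddity cycle is $(c_1,\dots,c_m)$ with $\eta(c_1)\cdots\eta(c_m)=-I$. The associated tame frieze pattern is built as follows: - extend $(c_k)$ $m$-periodically; - set $M_{i,j}=\eta(c_i)\cdots\eta(c_j)$ for $i-1\le j$, the empty product being $I$; - its entries are $a_{i,j+2}=(M_{i,j})_{1,1}$ for $i-1\le j\le i+m-3$. A diagonal of the $m$-gon with vertices $1,\dots,m$ (in cyclic order) is a pair $(i,j)$ with $1\le i<j\le m$, $j-i\ge2$, $(i,j)\ne(1,m)$. A triangulation (cluster) is a maximal set of pairwise non-crossing diagonals; the corresponding entries $a_{i,j}$ form a cluster of the frieze pattern. -}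

module Defs where

open import Level using (0ℓ)
open import Data.Fin.Base using (Fin; fromℕ<)
open import Data.Integer.Base as ℤ using (ℤ; 1ℤ)
open import Data.Integer.DivMod using (_%ℕ_; n%ℕd<d)
open import Data.Nat.Base as ℕ using (ℕ; zero; suc)
import Data.Nat.Properties as ℕ
open import Data.Product.Base using (∃; _×_; _,_)
open import Data.Rational.Base as ℚ using (ℚ; 0ℚ; 1ℚ; ½)
import Data.Rational.Properties as ℚ
open import Data.Rational.Solver using (module +-*-Solver)
open import Data.Sum.Base using (_⊎_)
open import Data.Vec.Functional using (Vector; foldr; map)
open import Relation.Binary.PropositionalEquality
  using (_≡_; refl; sym; trans; cong; subst)
open import Relation.Nullary.Negation.Core using (¬_)
open import Relation.Unary using (Pred; _⊆_)

-- Real numbers: Cauchy sequences of rationals, two sequences being equal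
-- when their difference tends to 0.

IsCauchy : (ℕ → ℚ) → Set
IsCauchy x = ∀ ε → 0ℚ ℚ.< ε →
  ∃ λ N → ∀ m n → N ℕ.≤ m → N ℕ.≤ n → ℚ.∣ x m ℚ.- x n ∣ ℚ.< ε

record ℝ : Set where
  constructor mkℝ
  field
    seq    : ℕ → ℚ
    cauchy : IsCauchy seq

open ℝ public

infix 4 _≈ᴿ_ _≈_ _≉_ _≈ᴹ_

_≈ᴿ_ : ℝ → ℝ → Set
x ≈ᴿ y = ∀ ε → 0ℚ ℚ.< ε →
  ∃ λ N → ∀ n → N ℕ.≤ n → ℚ.∣ seq x n ℚ.- seq y n ∣ ℚ.< ε

module CauchyLemmas where

  sub-add : ∀ a b → (a ℚ.- b) ℚ.+ b ≡ a
  sub-add = solve 2 (λ a b → (a :- b) :+ b := a) refl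
    where open +-*-Solver

  add-sub-add : ∀ a b c d →
    (a ℚ.- c) ℚ.+ (b ℚ.- d) ≡ (a ℚ.+ b) ℚ.- (c ℚ.+ d)
  add-sub-add =
    solve 4 (λ a b c d → (a :- c) :+ (b :- d) := (a :+ b) :- (c :+ d)) refl
    where open +-*-Solver

  neg-sub-neg : ∀ a b → b ℚ.- a ≡ ℚ.- a ℚ.- ℚ.- b
  neg-sub-neg = solve 2 (λ a b → b :- a := (:- a) :- (:- b)) refl
    where open +-*-Solver

  mul-sub-mul : ∀ a b c d →
    a ℚ.* (b ℚ.- d) ℚ.+ d ℚ.* (a ℚ.- c) ≡ a ℚ.* b ℚ.- c ℚ.* d
  mul-sub-mul =
    solve 4 (λ a b c d → a :* (b :- d) :+ d :* (a :- c) := a :* b :- c :* d)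
      refl
    where open +-*-Solver

  half-pos : ∀ {ε} → 0ℚ ℚ.< ε → 0ℚ ℚ.< ε ℚ.* ½
  half-pos {ε} 0<ε =
    subst (ℚ._< ε ℚ.* ½) (ℚ.*-zeroˡ ½) (ℚ.*-monoˡ-<-pos ½ 0<ε)

  half+half : ∀ ε → ε ℚ.* ½ ℚ.+ ε ℚ.* ½ ≡ ε
  half+half ε =
    trans (sym (ℚ.*-distribˡ-+ ε ½ ½)) (ℚ.*-identityʳ ε)

  ∣+∣< : ∀ p q {ε} → ℚ.∣ p ∣ ℚ.< ε ℚ.* ½ → ℚ.∣ q ∣ ℚ.< ε ℚ.* ½ →
         ℚ.∣ p ℚ.+ q ∣ ℚ.< ε
  ∣+∣< p q {ε} p< q< =
    ℚ.≤-<-trans (ℚ.∣p+q∣≤∣p∣+∣q∣ p q)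
      (subst (ℚ.∣ p ∣ ℚ.+ ℚ.∣ q ∣ ℚ.<_) (half+half ε) (ℚ.+-mono-< p< q<))

  ∣*∣< : ∀ p q {B δ} → ℚ.∣ p ∣ ℚ.< B → ℚ.∣ q ∣ ℚ.< δ →
         ℚ.∣ p ℚ.* q ∣ ℚ.< B ℚ.* δ
  ∣*∣< p q {B} {δ} p<B q<δ =
    subst (ℚ._< B ℚ.* δ) (sym (ℚ.∣p*q∣≡∣p∣*∣q∣ p q))
      (ℚ.≤-<-trans
        (ℚ.*-monoʳ-≤-nonNeg ℚ.∣ q ∣ {{ℚ.nonNegative (ℚ.0≤∣p∣ q)}} (ℚ.<⇒≤ p<B))
        (ℚ.*-monoʳ-<-pos B
          {{ℚ.positive (ℚ.≤-<-trans (ℚ.0≤∣p∣ p) p<B)}} q<δ))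

  fraction : ∀ {B ε} → 0ℚ ℚ.< B → 0ℚ ℚ.< ε → ∃ λ δ → 0ℚ ℚ.< δ × B ℚ.* δ ≡ ε
  fraction {B} {ε} 0<B 0<ε = 1/B ℚ.* ε , pos , eq
    where
    instance
      B-pos : ℚ.Positive B
      B-pos = ℚ.positive 0<B
      B-nonZero : ℚ.NonZero B
      B-nonZero = ℚ.pos⇒nonZero B
    1/B = ℚ.1/ B
    pos : 0ℚ ℚ.< 1/B ℚ.* ε
    pos = subst (ℚ._< 1/B ℚ.* ε) (ℚ.*-zeroʳ 1/B)
            (ℚ.*-monoʳ-<-pos 1/B {{ℚ.1/pos⇒pos B}} 0<ε)
    eq : B ℚ.* (1/B ℚ.* ε) ≡ ε
    eq = trans (sym (ℚ.*-assoc B 1/B ε))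
           (trans (cong (ℚ._* ε) (ℚ.*-inverseʳ B)) (ℚ.*-identityˡ ε))

  0<1 : 0ℚ ℚ.< 1ℚ
  0<1 = ℚ.positive⁻¹ 1ℚ

  bound : ∀ x → ∃ λ B → 0ℚ ℚ.< B ×
          ∃ λ N → ∀ n → N ℕ.≤ n → ℚ.∣ seq x n ∣ ℚ.< B
  bound x with cauchy x 1ℚ 0<1
  ... | N , close = B , 0<B , N , below
    where
    B = 1ℚ ℚ.+ ℚ.∣ seq x N ∣
    0<B : 0ℚ ℚ.< B
    0<B = ℚ.+-mono-<-≤ 0<1 (ℚ.0≤∣p∣ (seq x N))
    below : ∀ n → N ℕ.≤ n → ℚ.∣ seq x n ∣ ℚ.< B
    below n N≤n =
      subst (λ p → ℚ.∣ p ∣ ℚ.< B)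
        (sub-add (seq x n) (seq x N))
        (ℚ.≤-<-trans (ℚ.∣p+q∣≤∣p∣+∣q∣ (seq x n ℚ.- seq x N) (seq x N))
          (ℚ.+-mono-<-≤ (close n N N≤n ℕ.≤-refl) ℚ.≤-refl))

  product-close : ∀ a b c d {B₁ B₂ δ₁ δ₂ ε} →
    B₁ ℚ.* δ₁ ≡ ε ℚ.* ½ → B₂ ℚ.* δ₂ ≡ ε ℚ.* ½ →
    ℚ.∣ a ∣ ℚ.< B₁ → ℚ.∣ d ∣ ℚ.< B₂ →
    ℚ.∣ b ℚ.- d ∣ ℚ.< δ₁ → ℚ.∣ a ℚ.- c ∣ ℚ.< δ₂ →
    ℚ.∣ a ℚ.* b ℚ.- c ℚ.* d ∣ ℚ.< ε
  product-close a b c d {ε = ε} eq₁ eq₂ a< d< bd< ac< =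
    subst (λ p → ℚ.∣ p ∣ ℚ.< ε) (mul-sub-mul a b c d)
      (∣+∣< (a ℚ.* (b ℚ.- d)) (d ℚ.* (a ℚ.- c))
        (subst (ℚ.∣ a ℚ.* (b ℚ.- d) ∣ ℚ.<_) eq₁ (∣*∣< a (b ℚ.- d) a< bd<))
        (subst (ℚ.∣ d ℚ.* (a ℚ.- c) ∣ ℚ.<_) eq₂ (∣*∣< d (a ℚ.- c) d< ac<)))

  abstract

    const-cauchy : ∀ q → IsCauchy (λ _ → q)
    const-cauchy q ε 0<ε =
      0 , λ _ _ _ _ → subst (λ p → ℚ.∣ p ∣ ℚ.< ε) (sym (ℚ.+-inverseʳ q)) 0<ε

    +-cauchy : ∀ x y → IsCauchy (λ n → seq x n ℚ.+ seq y n)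
    +-cauchy x y ε 0<ε
      with cauchy x (ε ℚ.* ½) (half-pos 0<ε) | cauchy y (ε ℚ.* ½) (half-pos 0<ε)
    ... | N₁ , x< | N₂ , y< = N₁ ℕ.⊔ N₂ , λ m n N≤m N≤n →
      subst (λ p → ℚ.∣ p ∣ ℚ.< ε)
        (add-sub-add (seq x m) (seq y m) (seq x n) (seq y n))
        (∣+∣< (seq x m ℚ.- seq x n) (seq y m ℚ.- seq y n)
          (x< m n (ℕ.m⊔n≤o⇒m≤o N₁ N₂ N≤m) (ℕ.m⊔n≤o⇒m≤o N₁ N₂ N≤n))
          (y< m n (ℕ.m⊔n≤o⇒n≤o N₁ N₂ N≤m) (ℕ.m⊔n≤o⇒n≤o N₁ N₂ N≤n)))

    neg-cauchy : ∀ x → IsCauchy (λ n → ℚ.- seq x n)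
    neg-cauchy x ε 0<ε with cauchy x ε 0<ε
    ... | N , x< = N , λ m n N≤m N≤n →
      subst (λ p → ℚ.∣ p ∣ ℚ.< ε)
        (neg-sub-neg (seq x m) (seq x n))
        (x< n m N≤n N≤m)

    *-cauchy : ∀ x y → IsCauchy (λ n → seq x n ℚ.* seq y n)
    *-cauchy x y ε 0<ε =
      let B₁ , 0<B₁ , K₁ , x<    = bound x
          B₂ , 0<B₂ , K₂ , y<    = bound y
          δ₁ , 0<δ₁ , eq₁        = fraction 0<B₁ (half-pos 0<ε)
          δ₂ , 0<δ₂ , eq₂        = fraction 0<B₂ (half-pos 0<ε)
          N₁ , dy<               = cauchy y δ₁ 0<δ₁
          N₂ , dx<               = cauchy x δ₂ 0<δ₂
      in (K₁ ℕ.⊔ K₂) ℕ.⊔ (N₁ ℕ.⊔ N₂) , λ m n N≤m N≤n →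
      let K≤m = ℕ.m⊔n≤o⇒m≤o (K₁ ℕ.⊔ K₂) (N₁ ℕ.⊔ N₂) N≤m
          K≤n = ℕ.m⊔n≤o⇒m≤o (K₁ ℕ.⊔ K₂) (N₁ ℕ.⊔ N₂) N≤n
          M≤m = ℕ.m⊔n≤o⇒n≤o (K₁ ℕ.⊔ K₂) (N₁ ℕ.⊔ N₂) N≤m
          M≤n = ℕ.m⊔n≤o⇒n≤o (K₁ ℕ.⊔ K₂) (N₁ ℕ.⊔ N₂) N≤n
      in product-close (seq x m) (seq y m) (seq x n) (seq y n) eq₁ eq₂
           (x< m (ℕ.m⊔n≤o⇒m≤o K₁ K₂ K≤m)) (y< n (ℕ.m⊔n≤o⇒n≤o K₁ K₂ K≤n))
           (dy< m n (ℕ.m⊔n≤o⇒m≤o N₁ N₂ M≤m) (ℕ.m⊔n≤o⇒m≤o N₁ N₂ M≤n))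
           (dx< m n (ℕ.m⊔n≤o⇒n≤o N₁ N₂ M≤m) (ℕ.m⊔n≤o⇒n≤o N₁ N₂ M≤n))

open CauchyLemmas

infixl 6 _+ᴿ_ _+_
infixl 7 _*ᴿ_ _*_ _*ᴹ_
infix  8 -ᴿ_ -_ -ᴹ_

fromℚ : ℚ → ℝ
fromℚ q = mkℝ (λ _ → q) (const-cauchy q)

_+ᴿ_ : ℝ → ℝ → ℝ
x +ᴿ y = mkℝ (λ n → seq x n ℚ.+ seq y n) (+-cauchy x y)

-ᴿ_ : ℝ → ℝ
-ᴿ x = mkℝ (λ n → ℚ.- seq x n) (neg-cauchy x)

_*ᴿ_ : ℝ → ℝ → ℝ
x *ᴿ y = mkℝ (λ n → seq x n ℚ.* seq y n) (*-cauchy x y)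

record ℂ : Set where
  constructor _+i_
  field
    re im : ℝ

open ℂ public

_≈_ : ℂ → ℂ → Set
z ≈ w = (re z ≈ᴿ re w) × (im z ≈ᴿ im w)

_≉_ : ℂ → ℂ → Set
z ≉ w = ¬ (z ≈ w)

0ℂ 1ℂ : ℂ
0ℂ = fromℚ 0ℚ +i fromℚ 0ℚ
1ℂ = fromℚ 1ℚ +i fromℚ 0ℚ

_+_ : ℂ → ℂ → ℂ
z + w = (re z +ᴿ re w) +i (im z +ᴿ im w)

-_ : ℂ → ℂ
- z = (-ᴿ re z) +i (-ᴿ im z)

_*_ : ℂ → ℂ → ℂ
z * w = (re z *ᴿ re w +ᴿ -ᴿ (im z *ᴿ im w)) +i (re z *ᴿ im w +ᴿ im z *ᴿ re w)

record Mat₂ : Set where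
  constructor mat
  field
    e₁₁ e₁₂ e₂₁ e₂₂ : ℂ

open Mat₂ public

_≈ᴹ_ : Mat₂ → Mat₂ → Set
A ≈ᴹ B = (e₁₁ A ≈ e₁₁ B) × (e₁₂ A ≈ e₁₂ B) × (e₂₁ A ≈ e₂₁ B) × (e₂₂ A ≈ e₂₂ B)

_*ᴹ_ : Mat₂ → Mat₂ → Mat₂
A *ᴹ B = mat (e₁₁ A * e₁₁ B + e₁₂ A * e₂₁ B) (e₁₁ A * e₁₂ B + e₁₂ A * e₂₂ B)
             (e₂₁ A * e₁₁ B + e₂₂ A * e₂₁ B) (e₂₁ A * e₁₂ B + e₂₂ A * e₂₂ B)

Iᴹ : Mat₂
Iᴹ = mat 1ℂ 0ℂ
         0ℂ 1ℂ

-ᴹ_ : Mat₂ → Mat₂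
-ᴹ A = mat (- e₁₁ A) (- e₁₂ A) (- e₂₁ A) (- e₂₂ A)

η : ℂ → Mat₂
η c = mat c  (- 1ℂ)
          1ℂ 0ℂ

-- The entry c_k of (c₁,…,c_m) is stored at position k - 1 of the vector.

IsQuiddityCycle : ∀ {m} → Vector ℂ m → Set
IsQuiddityCycle c = foldr _*ᴹ_ Iᴹ (map η c) ≈ᴹ -ᴹ Iᴹ

module _ {m : ℕ} .{{_ : ℕ.NonZero m}} (c : Vector ℂ m) where

  periodic : ℤ → ℂ
  periodic k = c (fromℕ< (n%ℕd<d (k ℤ.- 1ℤ) m))

  -- η(c_i) η(c_{i+1}) ⋯ with the given number of factors.
  ηProduct : ℤ → ℕ → Mat₂
  ηProduct i zero    = Iᴹ
  ηProduct i (suc n) = η (periodic i) *ᴹ ηProduct (ℤ.suc i) n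

  -- M i j is η(c_i) ⋯ η(c_j) when i - 1 ≤ j; other values are irrelevant.
  M : ℤ → ℤ → Mat₂
  M i j = ηProduct i ℤ.∣ j ℤ.- i ℤ.+ 1ℤ ∣

  -- The frieze pattern consists of the entries with i + 1 ≤ j ≤ i + m - 1;
  -- these include all (i , j) with 1 ≤ i < j ≤ m.
  frieze : ℤ → ℤ → ℂ
  frieze i j = e₁₁ (M i (j ℤ.- ℤ.+ 2))

-- The m-gon has vertices 1,…,m, so a diagonal is a pair of naturals.
IsDiagonal : ℕ → Pred (ℕ × ℕ) 0ℓ
IsDiagonal m (i , j) =
  1 ℕ.≤ i × j ℕ.≤ m × i ℕ.+ 2 ℕ.≤ j × ¬ ((i , j) ≡ (1 , m))

-- For pairs with i < j and k < l: the segments meet in the open interior.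
Crossing : ℕ × ℕ → ℕ × ℕ → Set
Crossing (i , j) (k , l) =
  (i ℕ.< k × k ℕ.< j × j ℕ.< l) ⊎ (k ℕ.< i × i ℕ.< l × l ℕ.< j)

record IsNonCrossing (m : ℕ) (S : Pred (ℕ × ℕ) 0ℓ) : Set where
  field
    diagonals   : S ⊆ IsDiagonal m
    nonCrossing : ∀ {d e} → S d → S e → ¬ Crossing d e

record IsTriangulation (m : ℕ) (T : Pred (ℕ × ℕ) 0ℓ) : Set₁ where
  field
    isNonCrossing : IsNonCrossing m T
    maximal       : ∀ S → IsNonCrossing m S → T ⊆ S → S ⊆ T

-- The entries of a frieze pattern are determinants, a_{i,j} = det (u_i , u_j), of
-- the vectors given by u_{k+2} = c_k u_{k+1} - u_k.  Since det (u_j , u_{j+1}) = 1,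
-- the Plücker relation shows that "a_{i,j} = 0" is an equivalence relation on the
-- vertices: colour a vertex by its class.  Neighbouring vertices have different
-- colours, and c_k ≠ 0 says that k, k + 1, k + 2 have three different colours.
-- A properly coloured polygon with at least three colours has a triangulation all
-- of whose diagonals join vertices of different colours.

module Submission where

open import Algebra.Bundles using (CommutativeRing)
import Algebra.Consequences.Setoid as Consequences
open import Algebra.Definitions
import Algebra.Properties.Ring as RingProperties
import Algebra.Solver.Ring as RingSolver
open import Algebra.Solver.Ring.AlmostCommutativeRing
  using (fromCommutativeRing; _-Raw-AlmostCommutative⟶_)
open import Axiom.ExcludedMiddle using (ExcludedMiddle)
open import Data.Empty using (⊥-elim)
open import Data.Fin.Base as Fin using (toℕ)
open import Data.Fin.Properties using (toℕ-injective; toℕ-fromℕ<; toℕ<n)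
open import Data.Integer.Base as ℤ using (+_)
import Data.Integer.Solver as ℤSolver
open import Data.Maybe.Base using (map)
open import Data.Nat.Base as ℕ
  using (ℕ; NonZero; zero; suc; _≤_; _<_; z≤n; s≤s; s≤s⁻¹)
open import Data.Nat.DivMod using (m<n⇒m%n≡m)
import Data.Nat.Properties as ℕ
open import Data.Product.Base using (∃; _×_; _,_; proj₁; proj₂)
open import Data.Rational.Base as ℚ using (ℚ; 0ℚ; 1ℚ; ½)
import Data.Rational.Properties as ℚ
open import Data.Rational.Solver using (module +-*-Solver)
open import Data.Sum.Base using (_⊎_; inj₁; inj₂)
open import Data.Vec.Functional as Vector using (Vector)
open import Function.Base using (_∘_)
open import Level using (0ℓ)
open import Relation.Binary.Bundles using (Setoid)
open import Relation.Binary.Core using (Rel)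
open import Relation.Binary.PropositionalEquality as ≡ using (_≡_)
import Relation.Binary.Reasoning.Setoid as ≈-Reasoning
open import Relation.Binary.Structures using (IsEquivalence)
open import Relation.Nullary.Decidable.Core
  using (Dec; yes; no; decidable-stable; dec⇒maybe)
open import Relation.Nullary.Negation.Core using (¬_)
open import Relation.Unary using (Pred)

-- Triangulations of a polygon as binary trees

module Triangulations where

  open import Data.Nat.Base using (_+_)
  open import Data.Nat.Properties
  open import Defs using (IsDiagonal; Crossing; IsNonCrossing; IsTriangulation)
  open ≡ using (refl; sym; subst)

  -- Triangulations of the polygon with vertices i, …, j, recursively split at
  -- the apex k of the triangle on the side (i , j).
  data Tri : ℕ → ℕ → Set where
    side : ∀ i → Tri i (suc i)
    glue : ∀ {i k j} → Tri i k → Tri k j → Tri i j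

  -- The edges include the sides of the polygon; `Diagonal` discards these, together with the root
  -- chord (1 , m).
  data Edge : ∀ {i j} → Tri i j → ℕ → ℕ → Set where
    root  : ∀ {i j} {t : Tri i j} → Edge t i j
    left  : ∀ {i k j a b} {s : Tri i k} {t : Tri k j} →
            Edge s a b → Edge (glue s t) a b
    right : ∀ {i k j a b} {s : Tri i k} {t : Tri k j} →
            Edge t a b → Edge (glue s t) a b

  Tri⇒< : ∀ {i j} → Tri i j → i < j
  Tri⇒< (side i)   = n<1+n i
  Tri⇒< (glue s t) = <-trans (Tri⇒< s) (Tri⇒< t)

  Edge⇒bounds : ∀ {i j a b} {t : Tri i j} → Edge t a b → i ≤ a × a < b × b ≤ j
  Edge⇒bounds {t = t} root = ≤-refl , Tri⇒< t , ≤-refl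
  Edge⇒bounds {t = glue s t} (left e) with Edge⇒bounds e
  ... | i≤a , a<b , b≤k = i≤a , a<b , ≤-trans b≤k (<⇒≤ (Tri⇒< t))
  Edge⇒bounds {t = glue s t} (right e) with Edge⇒bounds e
  ... | k≤a , a<b , b≤j = ≤-trans (<⇒≤ (Tri⇒< s)) k≤a , a<b , b≤j

  -- The root chord spans all vertices, and two edges on different sides of the apex `k` lie in i,
  -- ..., k and in k, ..., j, so that they share at most the vertex `k`.
  edges-nonCrossing : ∀ {i j a b a′ b′} {t : Tri i j} →
    Edge t a b → Edge t a′ b′ → ¬ Crossing (a , b) (a′ , b′)
  edges-nonCrossing root e (inj₁ (_ , _ , j<b′)) =
    <⇒≱ j<b′ (proj₂ (proj₂ (Edge⇒bounds e)))
  edges-nonCrossing root e (inj₂ (a′<i , _ , _)) =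
    <⇒≱ a′<i (proj₁ (Edge⇒bounds e))
  edges-nonCrossing e@(left _) root (inj₁ (a<i , _ , _)) =
    <⇒≱ a<i (proj₁ (Edge⇒bounds e))
  edges-nonCrossing e@(left _) root (inj₂ (_ , _ , j<b)) =
    <⇒≱ j<b (proj₂ (proj₂ (Edge⇒bounds e)))
  edges-nonCrossing e@(right _) root (inj₁ (a<i , _ , _)) =
    <⇒≱ a<i (proj₁ (Edge⇒bounds e))
  edges-nonCrossing e@(right _) root (inj₂ (_ , _ , j<b)) =
    <⇒≱ j<b (proj₂ (proj₂ (Edge⇒bounds e)))
  edges-nonCrossing (left e)  (left e′)  cross = edges-nonCrossing e e′ cross
  edges-nonCrossing (right e) (right e′) cross = edges-nonCrossing e e′ cross
  edges-nonCrossing (left e) (right e′) cross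
    with Edge⇒bounds e | Edge⇒bounds e′ | cross
  ... | _ , _ , b≤k | k≤a′ , _ , _ | inj₁ (_ , a′<b , _) =
    <⇒≱ a′<b (≤-trans b≤k k≤a′)
  ... | _ , a<b , b≤k | k≤a′ , _ , _ | inj₂ (a′<a , _ , _) =
    <⇒≱ (<-trans a′<a a<b) (≤-trans b≤k k≤a′)
  edges-nonCrossing (right e) (left e′) cross
    with Edge⇒bounds e | Edge⇒bounds e′ | cross
  ... | k≤a , _ , _ | _ , a′<b′ , b′≤k | inj₁ (a<a′ , _ , _) =
    <⇒≱ (<-trans a<a′ a′<b′) (≤-trans b′≤k k≤a)
  ... | k≤a , _ , _ | _ , _ , b′≤k | inj₂ (_ , a<b′ , _) =
    <⇒≱ a<b′ (≤-trans b′≤k k≤a)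

  -- A chord (a , b) with a < k < b that is not the root crosses one of the
  -- other two sides (i , k), (k , j) of the root triangle.
  nonCrossing⇒Edge : ∀ {i j a b} (t : Tri i j) → i ≤ a → a < b → b ≤ j →
    (∀ {a′ b′} → Edge t a′ b′ → ¬ Crossing (a , b) (a′ , b′)) → Edge t a b
  nonCrossing⇒Edge {a = a} (side i) i≤a a<b b≤1+i nc
    with ≤-antisym i≤a (s≤s⁻¹ (≤-trans a<b b≤1+i))
  ... | refl with ≤-antisym b≤1+i a<b
  ... | refl = root
  nonCrossing⇒Edge {i} {j} {a} {b} (glue {k = k} s t) i≤a a<b b≤j nc
    with b ≤? k | k ≤? a
  ... | yes b≤k | _       =
    left (nonCrossing⇒Edge s i≤a a<b b≤k (λ e → nc (left e)))
  ... | no _    | yes k≤a =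
    right (nonCrossing⇒Edge t k≤a a<b b≤j (λ e → nc (right e)))
  ... | no b≰k  | no k≰a with m≤n⇒m<n∨m≡n i≤a
  ... | inj₁ i<a = ⊥-elim (nc (left root) (inj₂ (i<a , ≰⇒> k≰a , ≰⇒> b≰k)))
  ... | inj₂ refl with m≤n⇒m<n∨m≡n b≤j
  ... | inj₁ b<j = ⊥-elim (nc (right root) (inj₁ (≰⇒> k≰a , ≰⇒> b≰k , b<j)))
  ... | inj₂ refl = root

  Diagonal : ∀ {m} → Tri 1 m → Pred (ℕ × ℕ) 0ℓ
  Diagonal {m} t (a , b) = IsDiagonal m (a , b) × Edge t a b

  between⇒+2≤ : ∀ {a x b} → a < x → x < b → a + 2 ≤ b
  between⇒+2≤ {a} {b = b} a<x x<b =
    subst (_≤ b) (+-comm 2 a) (≤-trans (s≤s a<x) x<b)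

  -- A non-crossing set containing all of `Diagonal t` is not known to contain the sides of the
  -- polygon, but `nonCrossing⇒Edge` refers to every edge. This closes the gap: a crossed edge has
  -- an end of `d` strictly between its own ends, and one of its ends lies strictly between those of
  -- `d`.
  crossed⇒diagonal : ∀ {m a b} {t : Tri 1 m} {d} → IsDiagonal m d →
    Edge t a b → Crossing d (a , b) → IsDiagonal m (a , b)
  crossed⇒diagonal {m} (1≤i , j≤m , _ , _) e cross with Edge⇒bounds e | cross
  ... | 1≤a , _ , b≤m | inj₁ (i<a , a<j , j<b) =
    1≤a , b≤m , between⇒+2≤ a<j j<b , λ where refl → <⇒≱ i<a 1≤i
  ... | 1≤a , _ , b≤m | inj₂ (a<i , i<b , b<j) =
    1≤a , b≤m , between⇒+2≤ a<i i<b , λ where refl → <⇒≱ b<j j≤m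

  diagonals-isTriangulation : ∀ {m} (t : Tri 1 m) → IsTriangulation m (Diagonal t)
  diagonals-isTriangulation {m} t = record
    { isNonCrossing = record
      { diagonals   = proj₁
      ; nonCrossing = λ (_ , e) (_ , e′) → edges-nonCrossing e e′
      }
    ; maximal = λ S S-nc T⊆S {d} d∈S →
        let open IsNonCrossing S-nc
            diag = diagonals d∈S
            1≤i , j≤m , i+2≤j , _ = diag
        in diag , nonCrossing⇒Edge t 1≤i (<-≤-trans (m<m+n _ (s≤s z≤n)) i+2≤j)
             j≤m
             (λ e cross →
               nonCrossing d∈S (T⊆S (crossed⇒diagonal {d = d} diag e cross , e)) cross)
    }

  -- Triangulations of properly coloured polygons

  module Colouring {ℓ}
    (em : ExcludedMiddle ℓ)
    {_~_ : Rel ℕ ℓ} (~-isEquivalence : IsEquivalence _~_)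
    (proper : ∀ i → ¬ (i ~ suc i))
    where

    open IsEquivalence ~-isEquivalence
      renaming (refl to ~-refl; sym to ~-sym; trans to ~-trans)

    infix 4 _≁_
    _≁_ : Rel ℕ ℓ
    i ≁ j = ¬ (i ~ j)

    ≁-sym : ∀ {i j} → i ≁ j → j ≁ i
    ≁-sym i≁j j~i = i≁j (~-sym j~i)

    ~-≁-trans : ∀ {i j k} → i ~ j → j ≁ k → i ≁ k
    ~-≁-trans i~j j≁k i~k = j≁k (~-trans (~-sym i~j) i~k)

    ThirdColour : ℕ → ℕ → Set ℓ
    ThirdColour i j = ∃ λ k → i < k × k < j × k ≁ i × k ≁ j

    -- For `i ≁ j` this is necessary for a triangulation without unicoloured edges, as the apex over
    -- (i , j) must have a third colour; `properTri` shows that it is sufficient.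
    Splittable : ℕ → ℕ → Set ℓ
    Splittable i j = j ≡ suc i ⊎ ThirdColour i j

    -- If no inner vertex has a third colour, then i + 1, unlike i, must have the colour of k. Hence
    -- i + 2 differs in colour from k, so it is again an inner vertex and must have the colour of i.
    splittable-or-alternatingˡ : ∀ {i k} → i < k →
      Splittable i k ⊎ (2 + i < k × ((suc i) ~ k) × ((2 + i) ~ i))
    splittable-or-alternatingˡ {i} {k} i<k with m≤n⇒m<n∨m≡n i<k
    ... | inj₂ refl = inj₁ (inj₁ refl)
    ... | inj₁ 1+i<k with em {ThirdColour i k}
    ... | yes third = inj₁ (inj₂ third)
    ... | no ¬third = inj₂ (2+i<k , 1+i~k , 2+i~i)
      where
      1+i~k : (suc i) ~ k
      1+i~k = decidable-stable em λ 1+i≁k →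
        ¬third (suc i , n<1+n i , 1+i<k , ≁-sym (proper i) , 1+i≁k)
      2+i≁k : 2 + i ≁ k
      2+i≁k 2+i~k = proper (suc i) (~-trans 1+i~k (~-sym 2+i~k))
      2+i<k : 2 + i < k
      2+i<k = ≤∧≢⇒< 1+i<k λ where refl → 2+i≁k ~-refl
      2+i~i : (2 + i) ~ i
      2+i~i = decidable-stable em λ 2+i≁i →
        ¬third (2 + i , <-trans (n<1+n i) (n<1+n (suc i)) , 2+i<k , 2+i≁i , 2+i≁k)

    -- The mirror image, with `l` for j - 2 and `suc l` for j - 1.
    splittable-or-alternatingʳ : ∀ {k j} → k < j →
      Splittable k j ⊎ ∃ λ l → 2 + l ≡ j × k < l × ((suc l) ~ k) × (l ~ j)
    splittable-or-alternatingʳ {k} {j} k<j with m≤n⇒m<n∨m≡n k<j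
    ... | inj₂ refl = inj₁ (inj₁ refl)
    ... | inj₁ (s≤s (s≤s {n = l} k≤l)) with em {ThirdColour k j}
    ... | yes third = inj₁ (inj₂ third)
    ... | no ¬third = inj₂ (l , refl , k<l , 1+l~k , l~j)
      where
      1+l~k : (suc l) ~ k
      1+l~k = decidable-stable em λ 1+l≁k →
        ¬third (suc l , s≤s k≤l , n<1+n (suc l) , 1+l≁k , proper (suc l))
      l≁k : l ≁ k
      l≁k l~k = proper l (~-trans l~k (~-sym 1+l~k))
      k<l : k < l
      k<l = ≤∧≢⇒< k≤l λ where refl → l≁k ~-refl
      l~j : l ~ (2 + l)
      l~j = decidable-stable em λ l≁j →
        ¬third (l , k<l , <-trans (n<1+n l) (n<1+n (suc l)) , l≁k , l≁j)

    ProperTri : ℕ → ℕ → Set ℓ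
    ProperTri i j = ∃ λ (t : Tri i j) → ∀ {a b} → Edge t a b → a ≁ b

    properSide : ∀ i → ProperTri i (suc i)
    properSide i = side i , λ where root → proper i

    properGlue : ∀ {i k j} → i ≁ j → ProperTri i k → ProperTri k j → ProperTri i j
    properGlue i≁j (s , s-proper) (t , t-proper) = glue s t , λ where
      root      → i≁j
      (left e)  → s-proper e
      (right e) → t-proper e

    -- The apex over (i , j) is a vertex k of a third colour, unless i, …, k or
    -- k, …, j has only two colours; then i + 1, respectively j - 1, has the colour
    -- of k, and it is a good apex as i + 2, respectively j - 2, has that of i, j.
    properTri : ∀ n {i j} → j ≤ n + i → i < j → i ≁ j → Splittable i j →
                ProperTri i j
    properTri n _ _ _ (inj₁ refl) = properSide _
    -- The recursion is on `n`, a bound for the length j - i of the segment.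
    properTri zero j≤i i<j _ _ = ⊥-elim (<⇒≱ i<j j≤i)
    properTri (suc n) {i} {j} j≤ i<j i≁j (inj₂ (k , i<k , k<j , k≁i , k≁j))
      with splittable-or-alternatingˡ i<k | splittable-or-alternatingʳ k<j
    ... | inj₂ (2+i<k , 1+i~k , 2+i~i) | _ =
      properGlue i≁j (properSide i)
        (properTri n j≤n+1+i (<-trans (n<1+n (suc i)) 2+i<j) (~-≁-trans 1+i~k k≁j)
          (inj₂ (2 + i , n<1+n (suc i) , 2+i<j , ≁-sym (proper (suc i)) ,
                 ~-≁-trans 2+i~i i≁j)))
      where
      2+i<j = <-trans 2+i<k k<j
      j≤n+1+i = subst (j ≤_) (sym (+-suc n i)) j≤
    ... | inj₁ _ | inj₂ (l , refl , k<l , 1+l~k , l~j) =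
      properGlue i≁j
        (properTri n (s≤s⁻¹ j≤) (<-trans i<l (n<1+n l)) (≁-sym (~-≁-trans 1+l~k k≁i))
          (inj₂ (l , i<l , n<1+n l , ~-≁-trans l~j (≁-sym i≁j) , proper l)))
        (properSide (suc l))
      where
      i<l = <-trans i<k k<l
    ... | inj₁ splitˡ | inj₁ splitʳ =
      properGlue i≁j
        (properTri n (s≤s⁻¹ (<-≤-trans k<j j≤)) i<k (≁-sym k≁i) splitˡ)
        (properTri n (≤-trans j≤ (subst (_≤ n + k) (+-suc n i) (+-monoʳ-≤ n i<k))) k<j
          k≁j splitʳ)

    InRange : ℕ → ℕ → Set
    InRange m k = 1 ≤ k × k ≤ m

    -- The ends 1 and m account for at most two of the three colours, so one of the three vertices
    -- has a colour different from both. It is then neither 1 nor m, hence strictly inside.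
    thirdColour : ∀ {m x y z} → InRange m x → InRange m y → InRange m z →
      x ≁ y → y ≁ z → x ≁ z → ThirdColour 1 m
    thirdColour {m} {x} {y} {z} x-in y-in z-in x≁y y≁z x≁z = pick em em em em
      where
      inside : ∀ {w} → InRange m w → w ≁ 1 → w ≁ m → ThirdColour 1 m
      inside {w} (1≤w , w≤m) w≁1 w≁m = w ,
        ≤∧≢⇒< 1≤w (λ where refl → w≁1 ~-refl) ,
        ≤∧≢⇒< w≤m (λ where refl → w≁m ~-refl) , w≁1 , w≁m
      avoid : ∀ {v w k} → v ≁ w → v ~ k → w ≁ k
      avoid v≁w v~k = ≁-sym (~-≁-trans (~-sym v~k) v≁w)
      pick : Dec (x ~ 1) → Dec (x ~ m) → Dec (y ~ 1) → Dec (y ~ m) → ThirdColour 1 m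
      pick (no x≁1)  (no x≁m)  _         _         = inside x-in x≁1 x≁m
      pick (yes x~1) _         _         (no y≁m)  = inside y-in (avoid x≁y x~1) y≁m
      pick (yes x~1) _         _         (yes y~m) =
        inside z-in (avoid x≁z x~1) (avoid y≁z y~m)
      pick (no _)    (yes x~m) (no y≁1)  _         = inside y-in y≁1 (avoid x≁y x~m)
      pick (no _)    (yes x~m) (yes y~1) _         =
        inside z-in (avoid y≁z y~1) (avoid x≁z x~m)

-- The ring stays abstract so that the solver does not unfold ℂ; the coefficients
-- are there for the solver only, which needs a decidable coefficient ring.
module Continuants {a ℓ} (R : CommutativeRing a ℓ)
  (coefficient : ℚ.+-*-rawRing -Raw-AlmostCommutative⟶ fromCommutativeRing R)
  where

  open CommutativeRing R
  open _-Raw-AlmostCommutative⟶_ coefficient using (⟦_⟧)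
  open RingSolver ℚ.+-*-rawRing (fromCommutativeRing R) coefficient
    (λ p q → map (λ p≡q → reflexive (≡.cong ⟦_⟧ p≡q)) (dec⇒maybe (p ℚ.≟ q)))
    using (solve; _:=_; _:+_; _:*_; _:-_; :-_)
  open RingProperties ring
    using (-0#≈0#; -1*x≈-x; -‿distribʳ-*; -‿involutive; -‿+-comm; -‿injective)
  open ≈-Reasoning setoid

  -- Determinants of plane vectors

  det : Carrier × Carrier → Carrier × Carrier → Carrier
  det (x , y) (x′ , y′) = x * y′ - y * x′

  det-plücker : ∀ p q r s →
    det p r * det q s ≈ det p q * det r s + det p s * det q r
  det-plücker (p , p′) (q , q′) (r , r′) (s , s′) =
    solve 8 (λ p p′ q q′ r r′ s s′ →
        (p :* r′ :- p′ :* r) :* (q :* s′ :- q′ :* s) :=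
        (p :* q′ :- p′ :* q) :* (r :* s′ :- r′ :* s) :+
        (p :* s′ :- p′ :* s) :* (q :* r′ :- q′ :* r))
      refl p p′ q q′ r r′ s s′

  det-refl : ∀ p → det p p ≈ 0#
  det-refl (p , p′) = trans (+-congʳ (*-comm p p′)) (-‿inverseʳ (p′ * p))

  det-antisym : ∀ p q → det p q ≈ - det q p
  det-antisym (p , p′) (q , q′) =
    solve 4 (λ p p′ q q′ →
        p :* q′ :- p′ :* q := :- (q :* p′ :- q′ :* p))
      refl p p′ q q′

  continue : Carrier → Carrier × Carrier → Carrier × Carrier → Carrier × Carrier
  continue a (p , p′) (q , q′) = a * q - p , a * q′ - p′

  -- Bilinearity, arranged so that the recurrence is solved for its oldest term `p`: from the values
  -- at j + 1 and j + 2 one gets the value at j.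
  det-continueʳ : ∀ a p q r →
    a * det r q - det r (continue a p q) ≈ det r p
  det-continueʳ a (p , p′) (q , q′) (r , r′) =
    solve 7 (λ a p p′ q q′ r r′ →
        a :* (r :* q′ :- r′ :* q) :- (r :* (a :* q′ :- p′) :- r′ :* (a :* q :- p)) :=
        r :* p′ :- r′ :* p)
      refl a p p′ q q′ r r′

  det-continueˡ : ∀ a p q r →
    a * det q r - det (continue a p q) r ≈ det p r
  det-continueˡ a (p , p′) (q , q′) (r , r′) =
    solve 7 (λ a p p′ q q′ r r′ →
        a :* (q :* r′ :- q′ :* r) :- ((a :* q :- p) :* r′ :- (a :* q′ :- p′) :* r) :=
        p :* r′ :- p′ :* r)
      refl a p p′ q q′ r r′

  -- The step `(p , q) ↦ (q , a q - p)` has determinant 1, so determinants of consecutive vectors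
  -- keep their initial value.
  det-continue : ∀ a p q → det q (continue a p q) ≈ det p q
  det-continue a (p , p′) (q , q′) =
    solve 5 (λ a p p′ q q′ →
        q :* (a :* q′ :- p′) :- q′ :* (a :* q :- p) := p :* q′ :- p′ :* q)
      refl a p p′ q q′

  a*1-0≈a : ∀ a {x y} → x ≈ 1# → y ≈ 0# → a * x - y ≈ a
  a*1-0≈a a {x} {y} x≈1 y≈0 = begin
    a * x - y     ≈⟨ +-cong (*-congˡ x≈1) (-‿cong y≈0) ⟩
    a * 1# - 0#   ≈⟨ +-cong (*-identityʳ a) -0#≈0# ⟩
    a + 0#        ≈⟨ +-identityʳ a ⟩
    a             ∎

  -- The left-hand side is a second-row entry of `η c *ᴹ P`, with `x` and `y` a column of `P`.
  1*x+0*y≈z : ∀ x y {z} → x ≈ z → 1# * x + 0# * y ≈ z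
  1*x+0*y≈z x y {z} x≈z = begin
    1# * x + 0# * y  ≈⟨ +-cong (*-identityˡ x) (zeroˡ y) ⟩
    x + 0#           ≈⟨ +-identityʳ x ⟩
    x                ≈⟨ x≈z ⟩
    z                ∎

  -- Frieze entries as determinants

  module _ (d : ℕ → Carrier) where

    -- Starting from the standard basis gives `D 0 1` the value 1; the index of `d` is chosen so
    -- that `D i (2 + i)` is `d i`, matching a_{i,i+2} = c_i.
    u : ℕ → Carrier × Carrier
    u 0             = 1# , 0#
    u 1             = 0# , 1#
    u (suc (suc i)) = continue (d i) (u i) (u (suc i))

    -- The frieze entry a_{i,j} when i < j, extended to all i and j.
    D : ℕ → ℕ → Carrier
    D i j = det (u i) (u j)

    D-suc : ∀ i → D i (suc i) ≈ 1#
    D-suc 0 = a*1-0≈a 1# refl (zeroˡ 0#)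
    D-suc (suc i) = trans (det-continue (d i) (u i) (u (suc i))) (D-suc i)

    D-stepʳ : ∀ i j → d j * D i (suc j) - D i (2 ℕ.+ j) ≈ D i j
    D-stepʳ i j = det-continueʳ (d j) (u j) (u (suc j)) (u i)

    D-stepˡ : ∀ i j → d i * D (suc i) j - D (2 ℕ.+ i) j ≈ D i j
    D-stepˡ i j = det-continueˡ (d i) (u i) (u (suc i)) (u j)

    D≈0-refl : ∀ i → D i i ≈ 0#
    D≈0-refl i = det-refl (u i)

    D≈0-sym : ∀ i j → D i j ≈ 0# → D j i ≈ 0#
    D≈0-sym i j Dij≈0 = begin
      D j i    ≈⟨ det-antisym (u j) (u i) ⟩
      - D i j  ≈⟨ -‿cong Dij≈0 ⟩
      - 0#     ≈⟨ -0#≈0# ⟩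
      0#       ∎

    -- The Plücker relation is applied to i, j, k and the neighbour j + 1. Since `D j (suc j)` is 1,
    -- it writes `D i k` as a combination of the two vanishing entries.
    D≈0-trans : ∀ i j k → D i j ≈ 0# → D j k ≈ 0# → D i k ≈ 0#
    D≈0-trans i j k Dij≈0 Djk≈0 = begin
      D i k                    ≈⟨ *-identityʳ (D i k) ⟨
      D i k * 1#               ≈⟨ *-congˡ (D-suc j) ⟨
      D i k * D j l            ≈⟨ det-plücker (u i) (u j) (u k) (u l) ⟩
      D i j * D k l + D i l * D j k
        ≈⟨ +-cong (*-congʳ Dij≈0) (*-congˡ Djk≈0) ⟩
      0# * D k l + D i l * 0#  ≈⟨ +-cong (zeroˡ (D k l)) (zeroʳ (D i l)) ⟩
      0# + 0#                  ≈⟨ +-identityˡ 0# ⟩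
      0#                       ∎
      where l = suc j

    D-isEquivalence : IsEquivalence (λ i j → D i j ≈ 0#)
    D-isEquivalence = record
      { refl  = λ {i} → D≈0-refl i
      ; sym   = λ {i} {j} → D≈0-sym i j
      ; trans = λ {i} {j} {k} → D≈0-trans i j k
      }

    D-skip : ∀ i → D i (2 ℕ.+ i) ≈ d i
    D-skip i = begin
      D i j                            ≈⟨ D-stepˡ i j ⟨
      d i * D (suc i) j - D j j        ≈⟨ a*1-0≈a (d i) (D-suc (suc i)) (D≈0-refl j) ⟩
      d i                              ∎
      where j = 2 ℕ.+ i

    -- The counterpart of `D-skip` for a corner that wraps around the polygon: there `u (2 + j)` is,
    -- up to sign, the vector of vertex `i`.
    D-skip′ : ∀ i j → D i (suc j) ≈ 1# → D i (2 ℕ.+ j) ≈ 0# → D i j ≈ d j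
    D-skip′ i j eq₁ eq₀ = trans (sym (D-stepʳ i j)) (a*1-0≈a (d j) eq₁ eq₀)

    -- Applied with i = 1 and j = m, this makes m and 1 neighbours of different colours.
    D-reflect : ∀ i j → D i (suc j) ≈ 0# → D i (2 ℕ.+ j) ≈ - 1# → D i j ≈ 1#
    D-reflect i j eq₀ eq₋₁ = begin
      D i j                                ≈⟨ D-stepʳ i j ⟨
      d j * D i (suc j) - D i (2 ℕ.+ j)    ≈⟨ +-cong (*-congˡ eq₀) (-‿cong eq₋₁) ⟩
      d j * 0# - - 1#                      ≈⟨ +-cong (zeroʳ (d j)) (-‿involutive 1#) ⟩
      0# + 1#                              ≈⟨ +-identityˡ 1# ⟩
      1#                                   ∎

    -- The left-hand side is a first-row entry of `η (d i) *ᴹ P`, with `x` and `y` the first column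
    -- of `P`; `-D-row` treats the second column.
    D-row : ∀ i j {x y} → x ≈ D (suc i) j → y ≈ D (2 ℕ.+ i) j →
      d i * x + - 1# * y ≈ D i j
    D-row i j {x} {y} x≈D y≈D = begin
      d i * x + - 1# * y                     ≈⟨ +-cong (*-congˡ x≈D) (-1*x≈-x y) ⟩
      d i * D (suc i) j - y                  ≈⟨ +-congˡ (-‿cong y≈D) ⟩
      d i * D (suc i) j - D (2 ℕ.+ i) j      ≈⟨ D-stepˡ i j ⟩
      D i j                                  ∎

    -D-row : ∀ i j {x y} → x ≈ - D (suc i) j → y ≈ - D (2 ℕ.+ i) j →
      d i * x + - 1# * y ≈ - D i j
    -D-row i j {x} {y} x≈-D y≈-D = begin
      d i * x + - 1# * y          ≈⟨ +-cong (*-congˡ x≈-D) (*-congˡ y≈-D) ⟩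
      d i * - X + - 1# * - Y      ≈⟨ +-cong (-‿distribʳ-* (d i) X) (-‿distribʳ-* (- 1#) Y) ⟨
      - (d i * X) - - 1# * Y      ≈⟨ -‿+-comm (d i * X) (- 1# * Y) ⟩
      - (d i * X + - 1# * Y)      ≈⟨ -‿cong (D-row i j refl refl) ⟩
      - D i j                     ∎
      where
      X = D (suc i) j
      Y = D (2 ℕ.+ i) j

    0≈-D-diagonal : ∀ i → 0# ≈ - D i i
    0≈-D-diagonal i = trans (sym -0#≈0#) (-‿cong (sym (D≈0-refl i)))

    1≈-D-suc : ∀ i → 1# ≈ - D (suc i) i
    1≈-D-suc i = trans (sym (D-suc i)) (det-antisym (u i) (u (suc i)))

    -- From a quiddity cycle to a coloured polygon

    module _ (em : ExcludedMiddle ℓ) (1≉0 : ¬ 1# ≈ 0#) where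

      D-proper : ∀ i → ¬ D i (suc i) ≈ 0#
      D-proper i Dᵢ≈0 = 1≉0 (trans (sym (D-suc i)) Dᵢ≈0)

      open Triangulations.Colouring em D-isEquivalence D-proper

      -- The first four hypotheses are the entries of η(c_1) ⋯ η(c_m) = - I.
      nonvanishing-triangulation : ∀ m →
        D 1 (2 ℕ.+ m) ≈ - 1# → - D 1 (1 ℕ.+ m) ≈ - 0# →
        D 2 (2 ℕ.+ m) ≈ - 0# → - D 2 (1 ℕ.+ m) ≈ - 1# →
        ∀ k → 1 ≤ k → k ≤ m → 2 < m → ¬ d k ≈ 0# →
        ∃ λ (t : Triangulations.Tri 1 m) →
          ∀ {i j} → Triangulations.Edge t i j → ¬ D i j ≈ 0#
      nonvanishing-triangulation m e₁₁ e₁₂ e₂₁ e₂₂ k 1≤k k≤m 2<m dₖ≉0 =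
        properTri m (ℕ.m≤m+n m 1) (ℕ.<-trans (s≤s (s≤s z≤n)) 2<m) 1≁m
          (inj₂ third)
        where
        eq₁₁ : D 1 (1 ℕ.+ m) ≈ 0#
        eq₁₁ = -‿injective e₁₂
        D₁ₘ≈1 : D 1 m ≈ 1#
        D₁ₘ≈1 = D-reflect 1 m eq₁₁ e₁₁
        1≁m : 1 ≁ m
        1≁m D₁ₘ≈0 = 1≉0 (trans (sym D₁ₘ≈1) D₁ₘ≈0)
        1≤m = ℕ.≤-trans 1≤k k≤m
        third : ThirdColour 1 m
        -- A nonzero c_k gives the vertices k, k + 1, k + 2, read modulo m, three colours. For k = m
        -- they are m, 1, 2 and for k = m - 1 they are m - 1, m, 1; these two cases use the closing
        -- condition through `D-skip′`.
        third with ℕ.m≤n⇒m<n∨m≡n k≤m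
        ... | inj₂ ≡.refl = thirdColour {x = m} {1} {2}
          (1≤m , ℕ.≤-refl) (ℕ.≤-refl , 1≤m) (s≤s z≤n , ℕ.<⇒≤ 2<m)
          (≁-sym {1} {m} 1≁m) (D-proper 1)
          (≁-sym {2} {m} λ D₂ₘ≈0 → dₖ≉0
            (trans (sym (D-skip′ 2 m (-‿injective e₂₂) (trans e₂₁ -0#≈0#))) D₂ₘ≈0))
        ... | inj₁ k<m with ℕ.m≤n⇒m<n∨m≡n k<m
        ... | inj₂ ≡.refl = thirdColour {x = k} {m} {1}
          (1≤k , k≤m) (1≤m , ℕ.≤-refl) (ℕ.≤-refl , 1≤m)
          (D-proper k) (≁-sym {1} {m} 1≁m)
          (≁-sym {1} {k} λ D₁ₖ≈0 → dₖ≉0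
            (trans (sym (D-skip′ 1 k D₁ₘ≈1 eq₁₁)) D₁ₖ≈0))
        ... | inj₁ 2+k≤m = thirdColour {x = k} {suc k} {2 ℕ.+ k}
          (1≤k , k≤m) (s≤s z≤n , k<m) (s≤s z≤n , 2+k≤m)
          (D-proper k) (D-proper (suc k))
          (λ Dₖ≈0 → dₖ≉0 (trans (sym (D-skip k)) Dₖ≈0))

open import Defs
open CauchyLemmas
open Triangulations
open ≡ using (refl; sym; trans; cong; subst)

-- Identities in ℚ behind the laws of ℝ and ℂ

module RationalIdentities where

  open +-*-Solver

  neg-sub : ∀ a b → ℚ.- (a ℚ.- b) ≡ b ℚ.- a
  neg-sub = solve 2 (λ a b → :- (a :- b) := b :- a) refl

  sub-add-sub : ∀ a b c → (a ℚ.- b) ℚ.+ (b ℚ.- c) ≡ a ℚ.- c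
  sub-add-sub = solve 3 (λ a b c → (a :- b) :+ (b :- c) := a :- c) refl

  re-assoc : ∀ a b c d e f →
    (a ℚ.* c ℚ.+ ℚ.- (b ℚ.* d)) ℚ.* e ℚ.+ ℚ.- ((a ℚ.* d ℚ.+ b ℚ.* c) ℚ.* f) ≡
    a ℚ.* (c ℚ.* e ℚ.+ ℚ.- (d ℚ.* f)) ℚ.+ ℚ.- (b ℚ.* (c ℚ.* f ℚ.+ d ℚ.* e))
  re-assoc = solve 6 (λ a b c d e f →
    (a :* c :+ :- (b :* d)) :* e :+ :- ((a :* d :+ b :* c) :* f) :=
    a :* (c :* e :+ :- (d :* f)) :+ :- (b :* (c :* f :+ d :* e))) refl

  im-assoc : ∀ a b c d e f →
    (a ℚ.* c ℚ.+ ℚ.- (b ℚ.* d)) ℚ.* f ℚ.+ (a ℚ.* d ℚ.+ b ℚ.* c) ℚ.* e ≡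
    a ℚ.* (c ℚ.* f ℚ.+ d ℚ.* e) ℚ.+ b ℚ.* (c ℚ.* e ℚ.+ ℚ.- (d ℚ.* f))
  im-assoc = solve 6 (λ a b c d e f →
    (a :* c :+ :- (b :* d)) :* f :+ (a :* d :+ b :* c) :* e :=
    a :* (c :* f :+ d :* e) :+ b :* (c :* e :+ :- (d :* f))) refl

  re-identityˡ : ∀ a b → 1ℚ ℚ.* a ℚ.+ ℚ.- (0ℚ ℚ.* b) ≡ a
  re-identityˡ = solve 2 (λ a b → con 1ℚ :* a :+ :- (con 0ℚ :* b) := a) refl

  im-identityˡ : ∀ a b → 1ℚ ℚ.* b ℚ.+ 0ℚ ℚ.* a ≡ b
  im-identityˡ = solve 2 (λ a b → con 1ℚ :* b :+ con 0ℚ :* a := b) refl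

  re-distribˡ : ∀ a b c d e f →
    a ℚ.* (c ℚ.+ e) ℚ.+ ℚ.- (b ℚ.* (d ℚ.+ f)) ≡
    (a ℚ.* c ℚ.+ ℚ.- (b ℚ.* d)) ℚ.+ (a ℚ.* e ℚ.+ ℚ.- (b ℚ.* f))
  re-distribˡ = solve 6 (λ a b c d e f →
    a :* (c :+ e) :+ :- (b :* (d :+ f)) :=
    (a :* c :+ :- (b :* d)) :+ (a :* e :+ :- (b :* f))) refl

  im-distribˡ : ∀ a b c d e f →
    a ℚ.* (d ℚ.+ f) ℚ.+ b ℚ.* (c ℚ.+ e) ≡
    (a ℚ.* d ℚ.+ b ℚ.* c) ℚ.+ (a ℚ.* f ℚ.+ b ℚ.* e)
  im-distribˡ = solve 6 (λ a b c d e f →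
    a :* (d :+ f) :+ b :* (c :+ e) :=
    (a :* d :+ b :* c) :+ (a :* f :+ b :* e)) refl

  re-comm : ∀ a b c d →
    a ℚ.* c ℚ.+ ℚ.- (b ℚ.* d) ≡ c ℚ.* a ℚ.+ ℚ.- (d ℚ.* b)
  re-comm = solve 4 (λ a b c d →
    a :* c :+ :- (b :* d) := c :* a :+ :- (d :* b)) refl

  im-comm : ∀ a b c d → a ℚ.* d ℚ.+ b ℚ.* c ≡ c ℚ.* b ℚ.+ d ℚ.* a
  im-comm = solve 4 (λ a b c d → a :* d :+ b :* c := c :* b :+ d :* a) refl

  re-constant : ∀ a b → a ℚ.* b ≡ a ℚ.* b ℚ.+ ℚ.- (0ℚ ℚ.* 0ℚ)
  re-constant = solve 2 (λ a b → a :* b := a :* b :+ :- (con 0ℚ :* con 0ℚ)) refl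

  im-constant : ∀ a b → 0ℚ ≡ a ℚ.* 0ℚ ℚ.+ 0ℚ ℚ.* b
  im-constant = solve 2 (λ a b → con 0ℚ := a :* con 0ℚ :+ con 0ℚ :* b) refl

open RationalIdentities

-- Equality in ℝ and ℂ as a congruence

pointwise : ∀ x y → (∀ n → seq x n ≡ seq y n) → x ≈ᴿ y
pointwise x y x≡y ε 0<ε = 0 , λ n _ →
  subst (λ p → ℚ.∣ p ∣ ℚ.< ε)
    (trans (sym (ℚ.+-inverseʳ (seq y n))) (cong (ℚ._- seq y n) (sym (x≡y n)))) 0<ε

≈ᴿ-sym : ∀ x y → x ≈ᴿ y → y ≈ᴿ x
≈ᴿ-sym x y x≈y ε 0<ε with x≈y ε 0<ε
... | N , close = N , λ n N≤n →
  subst (ℚ._< ε) (trans (sym (ℚ.∣-p∣≡∣p∣ (seq x n ℚ.- seq y n)))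
    (cong ℚ.∣_∣ (neg-sub (seq x n) (seq y n)))) (close n N≤n)

+ᴿ-cong : ∀ x x′ y y′ → x ≈ᴿ x′ → y ≈ᴿ y′ → x +ᴿ y ≈ᴿ x′ +ᴿ y′
+ᴿ-cong x x′ y y′ x≈x′ y≈y′ ε 0<ε
  with x≈x′ (ε ℚ.* ½) (half-pos 0<ε) | y≈y′ (ε ℚ.* ½) (half-pos 0<ε)
... | N₁ , close₁ | N₂ , close₂ = N₁ ℕ.⊔ N₂ , λ n N≤n →
  subst (λ p → ℚ.∣ p ∣ ℚ.< ε) (add-sub-add (seq x n) (seq y n) (seq x′ n) (seq y′ n))
    (∣+∣< (seq x n ℚ.- seq x′ n) (seq y n ℚ.- seq y′ n)
      (close₁ n (ℕ.m⊔n≤o⇒m≤o N₁ N₂ N≤n)) (close₂ n (ℕ.m⊔n≤o⇒n≤o N₁ N₂ N≤n)))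

≈ᴿ-trans : ∀ x y z → x ≈ᴿ y → y ≈ᴿ z → x ≈ᴿ z
≈ᴿ-trans x y z x≈y y≈z ε 0<ε =
  let N₁ , close₁ = x≈y (ε ℚ.* ½) (half-pos 0<ε)
      N₂ , close₂ = y≈z (ε ℚ.* ½) (half-pos 0<ε)
  in N₁ ℕ.⊔ N₂ , λ n N≤n →
  subst (λ p → ℚ.∣ p ∣ ℚ.< ε) (sub-add-sub (seq x n) (seq y n) (seq z n))
    (∣+∣< (seq x n ℚ.- seq y n) (seq y n ℚ.- seq z n)
      (close₁ n (ℕ.m⊔n≤o⇒m≤o N₁ N₂ N≤n)) (close₂ n (ℕ.m⊔n≤o⇒n≤o N₁ N₂ N≤n)))

-ᴿ-cong : ∀ x y → x ≈ᴿ y → -ᴿ x ≈ᴿ -ᴿ y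
-ᴿ-cong x y x≈y ε 0<ε =
  let N , close = ≈ᴿ-sym x y x≈y ε 0<ε
  in N , λ n N≤n →
  subst (λ p → ℚ.∣ p ∣ ℚ.< ε) (neg-sub-neg (seq x n) (seq y n)) (close n N≤n)

-- As x y - x′ y′ = x (y - y′) + y′ (x - x′), it suffices to bound the Cauchy sequences `x` and `y′`
-- eventually and to make each difference smaller than ε / 2 divided by the matching bound.
*ᴿ-cong : ∀ x x′ y y′ → x ≈ᴿ x′ → y ≈ᴿ y′ → x *ᴿ y ≈ᴿ x′ *ᴿ y′
*ᴿ-cong x x′ y y′ x≈x′ y≈y′ ε 0<ε =
  let B₁ , 0<B₁ , K₁ , x<  = bound x
      B₂ , 0<B₂ , K₂ , y′< = bound y′
      δ₁ , 0<δ₁ , eq₁      = fraction 0<B₁ (half-pos 0<ε)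
      δ₂ , 0<δ₂ , eq₂      = fraction 0<B₂ (half-pos 0<ε)
      N₁ , dy<             = y≈y′ δ₁ 0<δ₁
      N₂ , dx<             = x≈x′ δ₂ 0<δ₂
  in (K₁ ℕ.⊔ K₂) ℕ.⊔ (N₁ ℕ.⊔ N₂) , λ n N≤n →
  let K≤n = ℕ.m⊔n≤o⇒m≤o (K₁ ℕ.⊔ K₂) (N₁ ℕ.⊔ N₂) N≤n
      M≤n = ℕ.m⊔n≤o⇒n≤o (K₁ ℕ.⊔ K₂) (N₁ ℕ.⊔ N₂) N≤n
  in product-close (seq x n) (seq y n) (seq x′ n) (seq y′ n) eq₁ eq₂
       (x< n (ℕ.m⊔n≤o⇒m≤o K₁ K₂ K≤n)) (y′< n (ℕ.m⊔n≤o⇒n≤o K₁ K₂ K≤n))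
       (dy< n (ℕ.m⊔n≤o⇒m≤o N₁ N₂ M≤n)) (dx< n (ℕ.m⊔n≤o⇒n≤o N₁ N₂ M≤n))

pointwiseℂ : ∀ z w → (∀ n → seq (re z) n ≡ seq (re w) n) →
  (∀ n → seq (im z) n ≡ seq (im w) n) → z ≈ w
pointwiseℂ z w re≡ im≡ = pointwise (re z) (re w) re≡ , pointwise (im z) (im w) im≡

≈-isEquivalence : IsEquivalence _≈_
≈-isEquivalence = record
  { refl  = λ {z} → pointwiseℂ z z (λ _ → refl) (λ _ → refl)
  ; sym   = λ {z} {w} (p , q) → ≈ᴿ-sym (re z) (re w) p , ≈ᴿ-sym (im z) (im w) q
  ; trans = λ {z} {w} {v} (p , q) (p′ , q′) →
      ≈ᴿ-trans (re z) (re w) (re v) p p′ , ≈ᴿ-trans (im z) (im w) (im v) q q′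
  }

≈-setoid : Setoid 0ℓ 0ℓ
≈-setoid = record { isEquivalence = ≈-isEquivalence }

+-cong : ∀ z z′ w w′ → z ≈ z′ → w ≈ w′ → z + w ≈ z′ + w′
+-cong z z′ w w′ (p , q) (p′ , q′) =
  +ᴿ-cong (re z) (re z′) (re w) (re w′) p p′ , +ᴿ-cong (im z) (im z′) (im w) (im w′) q q′

*-cong : ∀ z z′ w w′ → z ≈ z′ → w ≈ w′ → z * w ≈ z′ * w′
*-cong z z′ w w′ (p , q) (p′ , q′) =
  +ᴿ-cong (re z *ᴿ re w) (re z′ *ᴿ re w′) (-ᴿ (im z *ᴿ im w)) (-ᴿ (im z′ *ᴿ im w′))
    (*ᴿ-cong (re z) (re z′) (re w) (re w′) p p′)
    (-ᴿ-cong (im z *ᴿ im w) (im z′ *ᴿ im w′)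
      (*ᴿ-cong (im z) (im z′) (im w) (im w′) q q′)) ,
  +ᴿ-cong (re z *ᴿ im w) (re z′ *ᴿ im w′) (im z *ᴿ re w) (im z′ *ᴿ re w′)
    (*ᴿ-cong (re z) (re z′) (im w) (im w′) p q′)
    (*ᴿ-cong (im z) (im z′) (re w) (re w′) q p′)

-- The commutative ring ℂ

*-assoc : Associative _≈_ _*_
*-assoc z w v = pointwiseℂ (z * w * v) (z * (w * v))
  (λ n → re-assoc (seq (re z) n) (seq (im z) n) (seq (re w) n) (seq (im w) n)
                  (seq (re v) n) (seq (im v) n))
  (λ n → im-assoc (seq (re z) n) (seq (im z) n) (seq (re w) n) (seq (im w) n)
                  (seq (re v) n) (seq (im v) n))

*-comm : Commutative _≈_ _*_
*-comm z w = pointwiseℂ (z * w) (w * z)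
  (λ n → re-comm (seq (re z) n) (seq (im z) n) (seq (re w) n) (seq (im w) n))
  (λ n → im-comm (seq (re z) n) (seq (im z) n) (seq (re w) n) (seq (im w) n))

*-identityˡ : LeftIdentity _≈_ 1ℂ _*_
*-identityˡ z = pointwiseℂ (1ℂ * z) z
  (λ n → re-identityˡ (seq (re z) n) (seq (im z) n))
  (λ n → im-identityˡ (seq (re z) n) (seq (im z) n))

*-distribˡ-+ : _DistributesOverˡ_ _≈_ _*_ _+_
*-distribˡ-+ z w v = pointwiseℂ (z * (w + v)) (z * w + z * v)
  (λ n → re-distribˡ (seq (re z) n) (seq (im z) n) (seq (re w) n) (seq (im w) n)
                     (seq (re v) n) (seq (im v) n))
  (λ n → im-distribˡ (seq (re z) n) (seq (im z) n) (seq (re w) n) (seq (im w) n)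
                     (seq (re v) n) (seq (im v) n))

+-assoc : Associative _≈_ _+_
+-assoc z w v = pointwiseℂ (z + w + v) (z + (w + v))
  (λ n → ℚ.+-assoc (seq (re z) n) (seq (re w) n) (seq (re v) n))
  (λ n → ℚ.+-assoc (seq (im z) n) (seq (im w) n) (seq (im v) n))

+-comm : Commutative _≈_ _+_
+-comm z w = pointwiseℂ (z + w) (w + z)
  (λ n → ℚ.+-comm (seq (re z) n) (seq (re w) n))
  (λ n → ℚ.+-comm (seq (im z) n) (seq (im w) n))

+-identityˡ : LeftIdentity _≈_ 0ℂ _+_
+-identityˡ z = pointwiseℂ (0ℂ + z) z
  (λ n → ℚ.+-identityˡ (seq (re z) n)) (λ n → ℚ.+-identityˡ (seq (im z) n))

+-inverseˡ : LeftInverse _≈_ 0ℂ -_ _+_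
+-inverseˡ z = pointwiseℂ (- z + z) 0ℂ
  (λ n → ℚ.+-inverseˡ (seq (re z) n)) (λ n → ℚ.+-inverseˡ (seq (im z) n))

ℂ-commutativeRing : CommutativeRing 0ℓ 0ℓ
ℂ-commutativeRing = record
  { Carrier = ℂ ; _≈_ = _≈_ ; _+_ = _+_ ; _*_ = _*_ ; -_ = -_ ; 0# = 0ℂ ; 1# = 1ℂ
  ; isCommutativeRing = record
    { isRing = record
      { +-isAbelianGroup = record
        { isGroup = record
          { isMonoid = record
            { isSemigroup = record
              { isMagma = record
                { isEquivalence = ≈-isEquivalence
                ; ∙-cong        = λ {z} {z′} {w} {w′} → +-cong z z′ w w′
                }
              ; assoc = +-assoc
              }
            ; identity = comm∧idˡ⇒id {_∙_ = _+_} +-comm {0ℂ} +-identityˡ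
            }
          ; inverse = comm∧invˡ⇒inv {_∙_ = _+_} {_⁻¹ = -_} {e = 0ℂ} +-comm +-inverseˡ
          ; ⁻¹-cong = λ {z} {w} (p , q) →
              -ᴿ-cong (re z) (re w) p , -ᴿ-cong (im z) (im w) q
          }
        ; comm = +-comm
        }
      ; *-cong = λ {z} {z′} {w} {w′} → *-cong z z′ w w′
      ; *-assoc = *-assoc
      ; *-identity = comm∧idˡ⇒id {_∙_ = _*_} *-comm {1ℂ} *-identityˡ
      ; distrib = comm∧distrˡ⇒distr {_∙_ = _*_} {_◦_ = _+_}
          (λ {z} {z′} {w} {w′} → +-cong z z′ w w′) *-comm *-distribˡ-+
      }
    ; *-comm = *-comm
    }
  }
  where
  open Consequences ≈-setoid

fromℚᶜ : ℚ → ℂ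
fromℚᶜ q = fromℚ q +i fromℚ 0ℚ

fromℚᶜ-homomorphism :
  ℚ.+-*-rawRing -Raw-AlmostCommutative⟶ fromCommutativeRing ℂ-commutativeRing
fromℚᶜ-homomorphism = record
  { ⟦_⟧    = fromℚᶜ
  ; +-homo = λ p q → pointwiseℂ (fromℚᶜ (p ℚ.+ q)) (fromℚᶜ p + fromℚᶜ q)
      (λ _ → refl) (λ _ → refl)
  ; *-homo = λ p q → pointwiseℂ (fromℚᶜ (p ℚ.* q)) (fromℚᶜ p * fromℚᶜ q)
      (λ _ → re-constant p q)
      (λ _ → im-constant p q)
  ; -‿homo = λ p → pointwiseℂ (fromℚᶜ (ℚ.- p)) (- fromℚᶜ p)
      (λ _ → refl) (λ _ → refl)
  ; 0-homo = pointwiseℂ 0ℂ 0ℂ (λ _ → refl) (λ _ → refl)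
  ; 1-homo = pointwiseℂ 1ℂ 1ℂ (λ _ → refl) (λ _ → refl)
  }

1≉0 : 1ℂ ≉ 0ℂ
1≉0 (re≈ , _) with re≈ 1ℚ 0<1
... | N , close = ℚ.<-irrefl refl (close N ℕ.≤-refl)

module ℂ-Ring = CommutativeRing ℂ-commutativeRing
open Continuants ℂ-commutativeRing fromℚᶜ-homomorphism

-- Products of the matrices η in terms of determinants

-- The entry at (i , j + 1) comes from the product of the factors i, ..., j - 1, which are j - i in
-- number.
factor-count : ∀ i j n → i ℕ.+ suc n ≡ j →
  ℤ.∣ + suc j ℤ.- + 2 ℤ.- + i ℤ.+ + 1 ∣ ≡ suc n
factor-count i _ n refl = cong ℤ.∣_∣ (cancel (+ i) (+ n))
  where
  open ℤSolver.+-*-Solver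
  cancel : ∀ x y →
    + 1 ℤ.+ (x ℤ.+ (+ 1 ℤ.+ y)) ℤ.- + 2 ℤ.- x ℤ.+ + 1 ≡ + 1 ℤ.+ y
  cancel = solve 2 (λ x y →
    con (+ 1) :+ (x :+ (con (+ 1) :+ y)) :- con (+ 2) :- x :+ con (+ 1) :=
    con (+ 1) :+ y) refl

module _ {m : ℕ} .{{_ : NonZero m}} (c : Vector ℂ m) where

  d : ℕ → ℂ
  d k = periodic c (+ k)

  -- The product has the factors i, ..., j - 1. Splitting off the leftmost one raises `i` and keeps
  -- `j`: the new second row is the old first row, and the new first row is the recurrence in the
  -- first index of `D`.
  ηProduct≈D : ∀ i n j → n ℕ.+ i ≡ j → ηProduct c (+ i) n ≈ᴹ
    mat (D d i (suc j)) (- D d i j) (D d (suc i) (suc j)) (- D d (suc i) j)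
  ηProduct≈D i zero j refl =
    ℂ-Ring.sym {D d i (suc i)} {1ℂ} (D-suc d i) ,
    0≈-D-diagonal d i ,
    ℂ-Ring.sym {D d (suc i) (suc i)} {0ℂ} (D≈0-refl d (suc i)) ,
    1≈-D-suc d i
  ηProduct≈D i (suc n) j 1+n+i≡j =
    let P = ηProduct c (+ suc i) n
        p₁₁ , p₁₂ , p₂₁ , p₂₂ = ηProduct≈D (suc i) n j (trans (ℕ.+-suc n i) 1+n+i≡j)
    in D-row d i (suc j) {e₁₁ P} {e₂₁ P} p₁₁ p₂₁ ,
       -D-row d i j {e₁₂ P} {e₂₂ P} p₁₂ p₂₂ ,
       1*x+0*y≈z (e₁₁ P) (e₂₁ P) {D d (suc i) (suc j)} p₁₁ ,
       1*x+0*y≈z (e₁₂ P) (e₂₂ P) { - D d (suc i) j} p₁₂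

  frieze≈D : ∀ {i j} → i ℕ.+ 2 ≤ j → frieze c (+ i) (+ j) ≈ D d i j
  frieze≈D {i} {zero}  i+2≤0 = ⊥-elim (ℕ.n≮0 (ℕ.m+n≤o⇒n≤o i i+2≤0))
  frieze≈D {i} {suc j} i+2≤1+j =
    subst (λ n → e₁₁ (ηProduct c (+ i) n) ≈ D d i (suc j))
      {x = suc n} {y = ℤ.∣ + suc j ℤ.- + 2 ℤ.- + i ℤ.+ + 1 ∣}
      (sym (factor-count i j n i+1+n≡j))
      (proj₁ (ηProduct≈D i (suc n) j (trans (ℕ.+-comm (suc n) i) i+1+n≡j)))
    where
    n = proj₁ (ℕ.m≤n⇒∃[o]m+o≡n i+2≤1+j)
    i+1+n≡j : i ℕ.+ suc n ≡ j
    i+1+n≡j = ℕ.suc-injective (trans (sym (ℕ.+-suc i (suc n)))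
      (trans (sym (ℕ.+-assoc i 2 n)) (proj₂ (ℕ.m≤n⇒∃[o]m+o≡n i+2≤1+j))))

  -- Each removed factor turns the vector into its tail, so the induction needs an arbitrary start
  -- `i` and a vector `v` that agrees with the periodic sequence from `i` on.
  foldr≡ηProduct : ∀ n (v : Vector ℂ n) i →
    (∀ k → periodic c (+ (i ℕ.+ toℕ k)) ≡ v k) →
    Vector.foldr _*ᴹ_ Iᴹ (Vector.map η v) ≡ ηProduct c (+ i) n
  foldr≡ηProduct zero    v i v≡c = refl
  foldr≡ηProduct (suc n) v i v≡c = ≡.cong₂ (λ z → η z *ᴹ_)
    (trans (sym (v≡c Fin.zero)) (cong (λ k → periodic c (+ k)) (ℕ.+-identityʳ i)))
    (foldr≡ηProduct n (v ∘ Fin.suc) (suc i) λ k →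
      trans (cong (λ l → periodic c (+ l)) (sym (ℕ.+-suc i (toℕ k)))) (v≡c (Fin.suc k)))

  periodic-toℕ : ∀ k → periodic c (+ suc (toℕ k)) ≡ c k
  periodic-toℕ k = cong c (toℕ-injective
    (trans (toℕ-fromℕ< _) (m<n⇒m%n≡m (toℕ<n k))))

theorem5p4 : ExcludedMiddle 0ℓ →
    (m : ℕ) .{{_ : NonZero m}} → 4 ≤ m →
    (c : Vector ℂ m) → IsQuiddityCycle c →
    (∃ λ k → c k ≉ 0ℂ) →
    ∃ λ (T : Pred (ℕ × ℕ) 0ℓ) →
    IsTriangulation m T ×
    (∀ i j → T (i , j) → frieze c (+ i) (+ j) ≉ 0ℂ)
theorem5p4 em m 4≤m c c-quiddity (k , cₖ≉0) =
  Diagonal t , diagonals-isTriangulation t ,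
  λ i j ((_ , _ , i+2≤j , _) , e) frieze≈0 → nonvanishing e
    (compare (frieze c (+ i) (+ j)) (D (d c) i j) 0ℂ (frieze≈D c i+2≤j) frieze≈0)
  where
  compare : ∀ x y z → x ≈ y → x ≈ z → y ≈ z
  compare x y z x≈y x≈z = ℂ-Ring.trans {y} {x} {z} (ℂ-Ring.sym {x} {y} x≈y) x≈z

  P = ηProduct c (+ 1) m

  P≈-I : P ≈ᴹ -ᴹ Iᴹ
  P≈-I = subst (_≈ᴹ -ᴹ Iᴹ) (foldr≡ηProduct c m c 1 (periodic-toℕ c)) c-quiddity

  properTriangulation : ∃ λ (t : Tri 1 m) → ∀ {i j} → Edge t i j → D (d c) i j ≉ 0ℂ
  properTriangulation =
    -- The product over the whole cycle is evaluated twice, by determinants with i = 1 and j = m +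
    -- 1, and as - I.
    let p₁₁ , p₁₂ , p₂₁ , p₂₂ = ηProduct≈D c 1 m (suc m) (ℕ.+-comm m 1)
        q₁₁ , q₁₂ , q₂₁ , q₂₂ = P≈-I
    in nonvanishing-triangulation (d c) em 1≉0 m
         (compare (e₁₁ P) (D (d c) 1 (2 ℕ.+ m)) (- 1ℂ) p₁₁ q₁₁)
         (compare (e₁₂ P) (- D (d c) 1 (1 ℕ.+ m)) (- 0ℂ) p₁₂ q₁₂)
         (compare (e₂₁ P) (D (d c) 2 (2 ℕ.+ m)) (- 0ℂ) p₂₁ q₂₁)
         (compare (e₂₂ P) (- D (d c) 2 (1 ℕ.+ m)) (- 1ℂ) p₂₂ q₂₂)
         (suc (toℕ k)) (s≤s z≤n) (toℕ<n k) (ℕ.≤-trans (ℕ.n≤1+n 3) 4≤m)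
         (subst (_≉ 0ℂ) (sym (periodic-toℕ c k)) cₖ≉0)

  t = proj₁ properTriangulation
  nonvanishing : ∀ {i j} → Edge t i j → D (d c) i j ≉ 0ℂ
  nonvanishing = proj₂ properTriangulation
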